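{- Let $q=2$ and let $n,d$ be integers with $d\geq 1$ and $n\geq 2d+1$. For $0\leq i\leq d$ and $0\leq j\leq d$ let $$G_j(i)=\sum_{h=0}^{i}(-1)^{i-h}2^{j(j-i+h)+\binom{i-h}{2}}{i \brack h}_2{d-h \brack j}_2{n-d-i+h \brack n-d-j}_2 .$$ Then for all $0\leq i\leq d-1$ and $1\leq j\leq d$ we have $|G_j(i+1)|<|G_j(i)|$.
   Context: For integers $N\geq 0$ and $k$, the Gaussian binomial coefficient is ${N \brack k}_q=\prod_{t=1}^{k}\frac{q^{N-k+t}-1}{q^t-1}$ if $0\leq k\leq N$, and ${N\brack k}_q=0$ if $k<0$ or $k>N$. The numbers $G_j(i)$ are the eigenvalues of the Grassmann graph $G_2(n,d,j)$ (vertices: $d$-dimensional subspaces of $\mathbb{F}_2^n$, adjacent iff their intersection has dimension $d-j$). -}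

module Defs where

open import Data.Nat as ℕ using (ℕ; zero; suc; _∸_; _≤?_; NonZero)
open import Data.Nat.DivMod using (_/_)
import Data.Nat.Properties as P
open import Data.Integer as ℤ using (ℤ; +_; -_)
open import Relation.Nullary.Decidable using (does)
open import Data.Bool using (if_then_else_)

prodFrom : ℕ → ℕ → ℕ
prodFrom b zero = 1
prodFrom b (suc k) = prodFrom b k ℕ.* (2 ℕ.^ (b ℕ.+ suc k) ∸ 1)

one<pow : ∀ k → 1 ℕ.< 2 ℕ.^ suc k
one<pow zero = ℕ.s≤s (ℕ.s≤s ℕ.z≤n)
one<pow (suc k) = P.<-≤-trans (one<pow k) (P.m≤m+n (2 ℕ.^ suc k) _)

denNonZero : ∀ k → NonZero (prodFrom 0 k)
denNonZero zero = _
denNonZero (suc k) =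
  P.m*n≢0 (prodFrom 0 k) (2 ℕ.^ suc k ∸ 1) {{denNonZero k}} {{ℕ.>-nonZero (P.m<n⇒0<n∸m (one<pow k))}}

-- Gaussian binomial coefficient [N choose k]_2 (natural-number arguments),
-- = ∏_{t=1}^{k} (2^(N-k+t) - 1)/(2^t - 1) for k ≤ N, and 0 for k > N.
-- (The quotient is exact.)
gauss2 : ℕ → ℕ → ℕ
gauss2 N k = if does (k ≤? N)
  then (prodFrom (N ∸ k) k / prodFrom 0 k) {{denNonZero k}}
  else 0

choose2 : ℕ → ℕ
choose2 m = (m ℕ.* (m ∸ 1)) / 2

sgn : ℕ → ℤ
sgn zero = + 1
sgn (suc m) = - sgn m

sumTo : ℕ → (ℕ → ℤ) → ℤ
sumTo zero f = f 0
sumTo (suc m) f = sumTo m f ℤ.+ f (suc m)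

-- G_j(i) = Σ_{h=0}^{i} (-1)^{i-h} 2^{j(j-i+h) + C(i-h,2)} [i h]_2 [d-h j]_2 [n-d-i+h  n-d-j]_2
-- The exponent j(j-i+h) is written with truncated subtraction j ∸ (i ∸ h); whenever
-- j-i+h < 0 the last Gaussian factor vanishes (n-d-j > n-d-i+h), so the term is 0 anyway.
G : ℕ → ℕ → ℕ → ℕ → ℤ
G n d j i = sumTo i λ h →
  sgn (i ∸ h) ℤ.* (+ (2 ℕ.^ (j ℕ.* (j ∸ (i ∸ h)) ℕ.+ choose2 (i ∸ h))))
    ℤ.* (+ (gauss2 i h ℕ.* gauss2 (d ∸ h) j ℕ.* gauss2 (n ∸ d ∸ i ℕ.+ h) (n ∸ d ∸ j)))

{-# OPTIONS --safe #-}
-- Let u(h) be the absolute value of the summand h of G_j(i).  It vanishes for h > p = min(i, d − j),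
-- and it increases with h up to p while the signs alternate, so |G_j(i)| lies between
-- u(p) − u(p−1) and u(p).  Likewise |G_j(i+1)| is at most the absolute value of its leading summand.
-- The ratios to u(p) of that summand and of u(p−1) are explicit quotients of products of numbers
-- 2^k − 1, and n − d ≥ d + 1 makes their sum less than 1.
module Submission where

open import Defs
open import Data.Nat using (ℕ; _≤_; _<_; _+_; _*_; suc)
open import Data.Integer using (∣_∣)

open import Data.Nat using (zero; _∸_; _^_; _≤?_; z≤n; s≤s; NonZero; >-nonZero)
open import Data.Nat.Properties
open import Data.Nat.DivMod using (_/_; m*n/n≡m; +-distrib-/-∣ʳ; /-congˡ)
open import Data.Nat.Divisibility using (n∣m*n)
open import Data.Nat.Tactic.RingSolver using (solve-∀)
import Data.Integer as ℤ
import Data.Integer.Properties as ℤₚ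
open import Data.Product using (∃; _,_)
open import Data.Sum using (_⊎_; inj₁; inj₂)
open import Relation.Nullary using (Dec; yes; no; contradiction)
open import Relation.Nullary.Decidable using (dec-true; dec-false)
open import Relation.Binary.PropositionalEquality

-- The numbers 2^k - 1.

q : ℕ → ℕ
q k = 2 ^ k ∸ 1

1+q≡2^ : ∀ k → suc (q k) ≡ 2 ^ k
1+q≡2^ k = m+[n∸m]≡n (m^n>0 2 k)

q>0 : ∀ k → 0 < q (suc k)
q>0 k = m<n⇒0<n∸m (one<pow k)

q-nonZero : ∀ k → NonZero (q (suc k))
q-nonZero k = >-nonZero (q>0 k)

-- This is 2^a · 2^b = 2^(a+b) rewritten without subtraction, which brings identities between these
-- numbers within reach of `solve-∀`.
q-+ : ∀ a b → q (a + b) ≡ q a * q b + q a + q b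
q-+ a b = suc-injective (begin
  suc (q (a + b))               ≡⟨ 1+q≡2^ (a + b) ⟩
  2 ^ (a + b)                   ≡⟨ ^-distribˡ-+-* 2 a b ⟩
  2 ^ a * 2 ^ b                 ≡⟨ cong₂ _*_ (1+q≡2^ a) (1+q≡2^ b) ⟨
  suc (q a) * suc (q b)         ≡⟨ expand (q a) (q b) ⟩
  suc (q a * q b + q a + q b)   ∎)
  where
  open ≡-Reasoning
  expand : ∀ x y → suc x * suc y ≡ suc (x * y + x + y)
  expand = solve-∀

q-mono : ∀ {a b} → a ≤ b → q a ≤ q b
q-mono a≤b = ∸-monoˡ-≤ 1 (^-monoʳ-≤ 2 a≤b)

q≤2^ : ∀ k → q k ≤ 2 ^ k
q≤2^ k = m∸n≤m (2 ^ k) 1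

2^≤q-suc : ∀ k → 2 ^ k ≤ q (suc k)
2^≤q-suc k = subst₂ _≤_ (1+q≡2^ k) (sym (q-+ 1 k))
  (≤-trans (≤-reflexive (+-comm 1 (q k))) (≤-trans (m≤n+m (q k + 1) (q k)) (≤-reflexive (lemma (q k)))))
  where
  lemma : ∀ x → x + (x + 1) ≡ 1 * x + 1 + x
  lemma = solve-∀

-- The two sides differ by exactly `q b`.
q*2^≤q : ∀ a b → q a * 2 ^ b ≤ q (a + b)
q*2^≤q a b = subst₂ _≤_ (cong (q a *_) (1+q≡2^ b)) (sym (q-+ a b))
  (≤-trans (m≤m+n _ (q b)) (≤-reflexive (lemma (q a) (q b))))
  where
  lemma : ∀ x y → x * suc y + y ≡ x * y + x + y
  lemma = solve-∀

q*q<q : ∀ a b → q a * q (suc b) < q (a + suc b)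
q*q<q a b = subst (q a * q (suc b) <_) (sym (q-+ a (suc b)))
  (≤-<-trans (m≤m+n _ (q a)) (m<m+n _ (q>0 b)))

-- Gaussian binomials

-- The Gaussian binomial [a+b, b], by the q-Pascal rule.
qb : ℕ → ℕ → ℕ
qb zero    _       = 1
qb (suc _) zero    = 1
qb (suc a) (suc b) = qb a (suc b) + 2 ^ suc a * qb (suc a) b

qfact : ℕ → ℕ
qfact = prodFrom 0

qfact-nonZero : ∀ a b → NonZero (qfact a * qfact b)
qfact-nonZero a b = m*n≢0 (qfact a) (qfact b) {{denNonZero a}} {{denNonZero b}}

prodFrom-qfact : ∀ a b → prodFrom a b * qfact a ≡ qfact (a + b)
prodFrom-qfact a zero    = trans (*-identityˡ _) (cong qfact (sym (+-identityʳ a)))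
prodFrom-qfact a (suc b) = begin
  prodFrom a b * q (a + suc b) * qfact a ≡⟨ swap (prodFrom a b) _ _ ⟩
  prodFrom a b * qfact a * q (a + suc b) ≡⟨ cong (_* q (a + suc b)) (prodFrom-qfact a b) ⟩
  qfact (a + b) * q (a + suc b)          ≡⟨ cong (λ x → qfact (a + b) * q x) (+-suc a b) ⟩
  qfact (suc (a + b))                    ≡⟨ cong qfact (+-suc a b) ⟨
  qfact (a + suc b)                      ∎
  where
  open ≡-Reasoning
  swap : ∀ x y z → x * y * z ≡ x * z * y
  swap = solve-∀

-- Identifies the q-Pascal recursion with the quotient of q-factorials. Once denominators are
-- cleared, the recursive step is `q-+ (suc a) (suc b)`.
qb-qfact : ∀ a b → qb a b * (qfact a * qfact b) ≡ qfact (a + b)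
qb-qfact zero    b    = trans (*-identityˡ _) (*-identityˡ _)
qb-qfact (suc a) zero = trans (*-identityˡ _)
  (trans (*-identityʳ _) (cong qfact (sym (+-identityʳ (suc a)))))
qb-qfact (suc a) (suc b) = begin
  (qb a (suc b) + 2 ^ suc a * qb (suc a) b) * (qfact a * qa * (qfact b * qβ))
    ≡⟨ expand (qb a (suc b)) (2 ^ suc a) (qb (suc a) b) (qfact a) qa (qfact b) qβ ⟩
  qb a (suc b) * (qfact a * (qfact b * qβ)) * qa + qb (suc a) b * (qfact a * qa * qfact b) * (2 ^ suc a * qβ)
    ≡⟨ cong₂ (λ x y → x * qa + y * (2 ^ suc a * qβ)) (qb-qfact a (suc b)) (qb-qfact (suc a) b) ⟩
  qfact (a + suc b) * qa + qfact (suc (a + b)) * (2 ^ suc a * qβ)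
    ≡⟨ cong (λ x → qfact (a + suc b) * qa + x * (2 ^ suc a * qβ)) (cong qfact (sym (+-suc a b))) ⟩
  qfact (a + suc b) * qa + qfact (a + suc b) * (2 ^ suc a * qβ)
    ≡⟨ cong (λ x → qfact (a + suc b) * qa + qfact (a + suc b) * (x * qβ)) (1+q≡2^ (suc a)) ⟨
  qfact (a + suc b) * qa + qfact (a + suc b) * (suc qa * qβ)
    ≡⟨ collect (qfact (a + suc b)) qa qβ ⟩
  qfact (a + suc b) * (qa * qβ + qa + qβ)
    ≡⟨ cong (qfact (a + suc b) *_) (q-+ (suc a) (suc b)) ⟨
  qfact (suc a + suc b) ∎
  where
  open ≡-Reasoning
  qa = q (suc a)
  qβ = q (suc b)
  expand : ∀ u v w x α y β → (u + v * w) * (x * α * (y * β)) ≡ u * (x * (y * β)) * α + w * (x * α * y) * (v * β)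
  expand = solve-∀
  collect : ∀ f α β → f * α + f * (suc α * β) ≡ f * (α * β + α + β)
  collect = solve-∀

-- Multiplied by `qfact a * qfact b`, both sides become `qfact (suc a + b)`. Ratios are stated
-- cross-multiplied like this from here on, so that no division appears.
qb-sucˡ : ∀ a b → qb (suc a) b * q (suc a) ≡ qb a b * q (suc a + b)
qb-sucˡ a b = *-cancelʳ-≡ _ _ (qfact a * qfact b) {{qfact-nonZero a b}} (begin
  qb (suc a) b * q (suc a) * (qfact a * qfact b)   ≡⟨ left (qb (suc a) b) (q (suc a)) (qfact a) (qfact b) ⟩
  qb (suc a) b * (qfact a * q (suc a) * qfact b)   ≡⟨ qb-qfact (suc a) b ⟩
  qfact (a + b) * q (suc a + b)                    ≡⟨ cong (_* q (suc a + b)) (qb-qfact a b) ⟨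
  qb a b * (qfact a * qfact b) * q (suc a + b)     ≡⟨ right (qb a b) _ _ ⟩
  qb a b * q (suc a + b) * (qfact a * qfact b)     ∎)
  where
  open ≡-Reasoning
  left : ∀ u v x y → u * v * (x * y) ≡ u * (x * v * y)
  left = solve-∀
  right : ∀ u v x → u * v * x ≡ u * x * v
  right = solve-∀

qb-comm : ∀ a b → qb a b ≡ qb b a
qb-comm a b = *-cancelʳ-≡ _ _ (qfact a * qfact b) {{qfact-nonZero a b}} (begin
  qb a b * (qfact a * qfact b) ≡⟨ qb-qfact a b ⟩
  qfact (a + b)                ≡⟨ cong qfact (+-comm a b) ⟩
  qfact (b + a)                ≡⟨ qb-qfact b a ⟨
  qb b a * (qfact b * qfact a) ≡⟨ cong (qb b a *_) (*-comm (qfact b) (qfact a)) ⟩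
  qb b a * (qfact a * qfact b) ∎)
  where open ≡-Reasoning

-- The ratio of neighbours in one row of the q-Pascal triangle: by symmetry both sides equal
-- `qb a b * q (suc a + b)`.
qb-shift : ∀ a b → qb (suc a) b * q (suc a) ≡ qb a (suc b) * q (suc b)
qb-shift a b = begin
  qb (suc a) b * q (suc a) ≡⟨ qb-sucˡ a b ⟩
  qb a b * q (suc a + b)   ≡⟨ cong₂ (λ x y → x * q (suc y)) (qb-comm a b) (+-comm a b) ⟩
  qb b a * q (suc b + a)   ≡⟨ qb-sucˡ b a ⟨
  qb (suc b) a * q (suc b) ≡⟨ cong (_* q (suc b)) (qb-comm (suc b) a) ⟩
  qb a (suc b) * q (suc b) ∎
  where open ≡-Reasoning

qb>0 : ∀ a b → 0 < qb a b
qb>0 zero    b       = s≤s z≤n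
qb>0 (suc a) zero    = s≤s z≤n
qb>0 (suc a) (suc b) = ≤-trans (qb>0 a (suc b)) (m≤m+n _ _)

gauss2-qb : ∀ a b → gauss2 (a + b) b ≡ qb a b
gauss2-qb a b rewrite dec-true (b ≤? (a + b)) (m≤n+m b a) | m+n∸n≡m a b =
  trans (/-congˡ {{denNonZero b}} (sym quotient)) (m*n/n≡m (qb a b) (qfact b) {{denNonZero b}})
  where
  quotient : qb a b * qfact b ≡ prodFrom a b
  quotient = *-cancelʳ-≡ _ _ (qfact a) {{denNonZero a}}
    (trans (swap (qb a b) _ _) (trans (qb-qfact a b) (sym (prodFrom-qfact a b))))
    where
    swap : ∀ x y z → x * y * z ≡ x * (z * y)
    swap = solve-∀

gauss2-zero : ∀ {N k} → N < k → gauss2 N k ≡ 0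
gauss2-zero {N} {k} N<k rewrite dec-false (k ≤? N) (<⇒≱ N<k) = refl

choose2-suc : ∀ s → choose2 (suc s) ≡ s + choose2 s
choose2-suc zero    = refl
choose2-suc (suc k) = begin
  (suc (suc k) * suc k) / 2               ≡⟨ /-congˡ {o = 2} (split k) ⟩
  (suc k * k + suc k * 2) / 2             ≡⟨ +-distrib-/-∣ʳ (suc k * k) (n∣m*n (suc k)) ⟩
  choose2 (suc k) + (suc k * 2) / 2       ≡⟨ cong (choose2 (suc k) +_) (m*n/n≡m (suc k) 2) ⟩
  choose2 (suc k) + suc k                 ≡⟨ +-comm (choose2 (suc k)) (suc k) ⟩
  suc k + choose2 (suc k)                 ∎
  where
  open ≡-Reasoning
  split : ∀ k → suc (suc k) * suc k ≡ suc k * k + suc k * 2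
  split = solve-∀

-- Alternating sums

-- The alternating sum u(p) - u(p-1) + ... ± u(0), kept in ℕ. For increasing `u` nothing is
-- truncated.
alt : (ℕ → ℕ) → ℕ → ℕ
alt u zero    = u zero
alt u (suc p) = u (suc p) ∸ alt u p

-- The value 0 at the start stands for the missing predecessor, so bounds on it cover that case as
-- well.
prev : (ℕ → ℕ) → ℕ → ℕ
prev u zero    = 0
prev u (suc p) = u p

alt≤ : ∀ u p → alt u p ≤ u p
alt≤ u zero    = ≤-refl
alt≤ u (suc p) = m∸n≤m (u (suc p)) (alt u p)

-- The subtracted term `alt u p` is itself at most `u p`, so `u (suc p)` loses no more than its
-- predecessor.
≤alt+prev : ∀ u p → u p ≤ alt u p + prev u p
≤alt+prev u zero    = m≤m+n _ _
≤alt+prev u (suc p) = begin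
  u (suc p)                               ≤⟨ m≤n+m∸n (u (suc p)) (alt u p) ⟩
  alt u p + (u (suc p) ∸ alt u p)         ≤⟨ +-monoˡ-≤ _ (alt≤ u p) ⟩
  u p + (u (suc p) ∸ alt u p)             ≡⟨ +-comm (u p) _ ⟩
  (u (suc p) ∸ alt u p) + u p             ∎
  where open ≤-Reasoning

sumTo-alternating : ∀ i {F u} → (∀ h → F h ≡ sgn (i ∸ h) ℤ.* (ℤ.+ u h)) →
  ∀ p → p ≤ i → (∀ h → h < p → u h ≤ u (suc h)) →
  sumTo p F ≡ sgn (i ∸ p) ℤ.* (ℤ.+ alt u p)
sumTo-alternating i         F≡ zero    _   _  = F≡ 0
sumTo-alternating i {F} {u} F≡ (suc p) p<i u≤ = begin
  sumTo p F ℤ.+ F (suc p)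
    ≡⟨ cong₂ ℤ._+_ (sumTo-alternating i F≡ p (<⇒≤ p<i) (λ h h<p → u≤ h (m<n⇒m<1+n h<p))) (F≡ (suc p)) ⟩
  sgn (i ∸ p) ℤ.* A ℤ.+ σ ℤ.* U
    -- Since `p < i`, `i ∸ p` is the successor of `i ∸ suc p`, so the sign flips.
    ≡⟨ cong (λ x → sgn x ℤ.* A ℤ.+ σ ℤ.* U) (+-∸-assoc 1 p<i) ⟩
  (ℤ.- σ) ℤ.* A ℤ.+ σ ℤ.* U
    ≡⟨ cong (ℤ._+ σ ℤ.* U) (trans (sym (ℤₚ.neg-distribˡ-* σ A)) (ℤₚ.neg-distribʳ-* σ A)) ⟩
  σ ℤ.* (ℤ.- A) ℤ.+ σ ℤ.* U
    ≡⟨ ℤₚ.*-distribˡ-+ σ (ℤ.- A) U ⟨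
  σ ℤ.* (ℤ.- A ℤ.+ U)
    ≡⟨ cong (σ ℤ.*_) (ℤₚ.+-comm (ℤ.- A) U) ⟩
  σ ℤ.* (U ℤ.- A)
    -- Monotonicity makes the integer difference a natural number: `alt u p ≤ u p ≤ u (suc p)`.
    ≡⟨ cong (σ ℤ.*_) (trans (ℤₚ.m-n≡m⊖n (u (suc p)) (alt u p))
         (ℤₚ.⊖-≥ (≤-trans (alt≤ u p) (u≤ p ≤-refl)))) ⟩
  σ ℤ.* (ℤ.+ (u (suc p) ∸ alt u p)) ∎
  where
  open ≡-Reasoning
  σ = sgn (i ∸ suc p)
  A = ℤ.+ alt u p
  U = ℤ.+ u (suc p)

sumTo-vanishing : ∀ F p k → (∀ h → p < h → h ≤ k + p → F h ≡ ℤ.+ 0) → sumTo (k + p) F ≡ sumTo p F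
sumTo-vanishing F p zero    _  = refl
sumTo-vanishing F p (suc k) F0 = trans
  (cong₂ ℤ._+_ (sumTo-vanishing F p k (λ h p<h h≤ → F0 h p<h (m≤n⇒m≤1+n h≤)))
               (F0 (suc k + p) (s≤s (m≤n+m p k)) ≤-refl))
  (ℤₚ.+-identityʳ _)

∣sgn∣≡1 : ∀ k → ∣ sgn k ∣ ≡ 1
∣sgn∣≡1 zero    = refl
∣sgn∣≡1 (suc k) = trans (ℤₚ.∣-i∣≡∣i∣ (sgn k)) (∣sgn∣≡1 k)

∣sgn*∣ : ∀ k v → ∣ sgn k ℤ.* (ℤ.+ v) ∣ ≡ v
∣sgn*∣ k v = trans (ℤₚ.abs-* (sgn k) (ℤ.+ v)) (trans (cong (_* v) (∣sgn∣≡1 k)) (*-identityˡ v))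

-- Absolute values of the summands

-- Here m stands for n − d.
coef : ℕ → ℕ → ℕ → ℕ → ℕ → ℕ
coef m d j i h =
  2 ^ (j * (j ∸ (i ∸ h)) + choose2 (i ∸ h)) * (gauss2 i h * gauss2 (d ∸ h) j * gauss2 (m ∸ i + h) (m ∸ j))

-- The summand h = p of G_j(i), in the subtraction-free coordinates
-- i = s + p, j = s + r, d = p + (c + j), n − d = w + j.
T : ℕ → ℕ → ℕ → ℕ → ℕ → ℕ
T s p r c w = 2 ^ ((s + r) * r + choose2 s) * (qb s p * qb c (s + r) * qb r w)

-- From `p ≤ w` it follows that i = s + p is at most m = w + (s + r), so no subtraction truncates.
gauss2-last : ∀ s p r w → p ≤ w → gauss2 (w + (s + r) ∸ (s + p) + p) w ≡ qb r w
gauss2-last s p r w p≤w = trans (cong (λ x → gauss2 x w) top) (gauss2-qb r w)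
  where
  open ≡-Reasoning
  rotate : ∀ w s r → w + (s + r) ≡ s + (r + w)
  rotate = solve-∀
  top : w + (s + r) ∸ (s + p) + p ≡ r + w
  top = begin
    w + (s + r) ∸ (s + p) + p   ≡⟨ cong (λ x → x ∸ (s + p) + p) (rotate w s r) ⟩
    s + (r + w) ∸ (s + p) + p   ≡⟨ cong (_+ p) ([m+n]∸[m+o]≡n∸o s (r + w) p) ⟩
    (r + w) ∸ p + p             ≡⟨ m∸n+n≡m (≤-trans p≤w (m≤n+m w r)) ⟩
    r + w                       ∎

-- The coordinates enter through equations, so that rearranged forms such as `s + suc r` for
-- `suc s + r` can be supplied.
coef-T : ∀ s p r c w {m d j i} → i ≡ s + p → j ≡ s + r → d ≡ p + (c + j) → m ≡ w + j → p ≤ w →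
  coef m d j i p ≡ T s p r c w
coef-T s p r c w refl refl refl refl p≤w = cong₂ _*_
  (cong₂ (λ x y → 2 ^ ((s + r) * x + choose2 y)) (trans (cong (s + r ∸_) s≡) (m+n∸m≡n s r)) s≡)
  (cong₂ _*_
    (cong₂ _*_
      (gauss2-qb s p)
      (trans (cong (λ x → gauss2 x (s + r)) (m+n∸m≡n p (c + (s + r)))) (gauss2-qb c (s + r))))
    (trans (cong (gauss2 (w + (s + r) ∸ (s + p) + p)) (m+n∸n≡m w (s + r))) (gauss2-last s p r w p≤w)))
  where
  s≡ : s + p ∸ p ≡ s
  s≡ = m+n∸n≡m s p

T>0 : ∀ s p r c w → 0 < T s p r c w
T>0 s p r c w = *-mono-< (m^n>0 2 ((s + r) * r + choose2 s))
  (*-mono-< (*-mono-< (qb>0 s p) (qb>0 c (s + r))) (qb>0 r w))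

-- Multiplies four cross-multiplied ratios: one for the power of 2 and one for each Gaussian
-- binomial.
T-ratio : ∀ E′ A′ B′ C′ e a b c E A B C a′ b′ c′ →
  E′ * e ≡ E → A′ * a ≡ A * a′ → B′ * b ≡ B * b′ → C′ * c ≡ C * c′ →
  E′ * (A′ * B′ * C′) * (e * (a * b * c)) ≡ E * (A * B * C) * (a′ * b′ * c′)
T-ratio E′ A′ B′ C′ e a b c E A B C a′ b′ c′ eE eA eB eC = begin
  E′ * (A′ * B′ * C′) * (e * (a * b * c))           ≡⟨ split E′ A′ B′ C′ e a b c ⟩
  E′ * e * ((A′ * a) * (B′ * b) * (C′ * c))         ≡⟨ cong₂ _*_ eE (cong₂ _*_ (cong₂ _*_ eA eB) eC) ⟩
  E * ((A * a′) * (B * b′) * (C * c′))              ≡⟨ merge E A B C a′ b′ c′ ⟩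
  E * (A * B * C) * (a′ * b′ * c′)                  ∎
  where
  open ≡-Reasoning
  split : ∀ E A B C e a b c → E * (A * B * C) * (e * (a * b * c)) ≡ E * e * ((A * a) * (B * b) * (C * c))
  split = solve-∀
  merge : ∀ E A B C a b c → E * ((A * a) * (B * b) * (C * c)) ≡ E * (A * B * C) * (a * b * c)
  merge = solve-∀

-- With j = s + r + 1 fixed, the product in the exponent grows by j while the binomial term drops by
-- s, a net gain of r + 1.
power-ratio : ∀ s r → 2 ^ ((suc s + r) * r + choose2 (suc s)) * 2 ^ suc r ≡ 2 ^ ((s + suc r) * suc r + choose2 s)
power-ratio s r = begin
  2 ^ ((suc s + r) * r + choose2 (suc s)) * 2 ^ suc r   ≡⟨ ^-distribˡ-+-* 2 ((suc s + r) * r + choose2 (suc s)) (suc r) ⟨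
  2 ^ ((suc s + r) * r + choose2 (suc s) + suc r)       ≡⟨ cong (λ x → 2 ^ ((suc s + r) * r + x + suc r)) (choose2-suc s) ⟩
  2 ^ ((suc s + r) * r + (s + choose2 s) + suc r)       ≡⟨ cong (2 ^_) (regroup s r (choose2 s)) ⟩
  2 ^ ((s + suc r) * suc r + choose2 s)                 ∎
  where
  open ≡-Reasoning
  regroup : ∀ s r x → (suc s + r) * r + (s + x) + suc r ≡ (s + suc r) * suc r + x
  regroup = solve-∀

-- The previous summand of the same G_j(i).
T-prev : ∀ s p r c w →
  T (suc s) p r (suc c) w * (2 ^ suc r * (q (suc s) * q (suc c) * q (suc r + w))) ≡
  T s (suc p) (suc r) c w * (q (suc p) * q (suc c + (s + suc r)) * q (suc r))
T-prev s p r c w = T-ratio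
  (2 ^ ((suc s + r) * r + choose2 (suc s))) (qb (suc s) p) (qb (suc c) (suc s + r)) (qb r w)
  (2 ^ suc r) (q (suc s)) (q (suc c)) (q (suc r + w))
  (2 ^ ((s + suc r) * suc r + choose2 s)) (qb s (suc p)) (qb c (s + suc r)) (qb (suc r) w)
  (q (suc p)) (q (suc c + (s + suc r))) (q (suc r))
  (power-ratio s r) (qb-shift s p) sucs (sym (qb-sucˡ r w))
  where
  sucs : qb (suc c) (suc s + r) * q (suc c) ≡ qb c (s + suc r) * q (suc c + (s + suc r))
  sucs rewrite +-suc s r = qb-sucˡ c (suc (s + r))

-- The leading summands of G_j(i) and G_j(i+1) when i + j ≥ d.
T-next-≥ : ∀ s p r w →
  T (suc s) p r 0 w * (2 ^ suc r * (q (suc s) * 1 * q (suc r + w))) ≡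
  T s p (suc r) 0 w * (q (suc s + p) * 1 * q (suc r))
T-next-≥ s p r w = T-ratio
  (2 ^ ((suc s + r) * r + choose2 (suc s))) (qb (suc s) p) 1 (qb r w)
  (2 ^ suc r) (q (suc s)) 1 (q (suc r + w))
  (2 ^ ((s + suc r) * suc r + choose2 s)) (qb s p) 1 (qb (suc r) w)
  (q (suc s + p)) 1 (q (suc r))
  (power-ratio s r) (qb-sucˡ s p) refl (sym (qb-sucˡ r w))

-- The leading summands of G_j(i) and G_j(i+1) when i + j < d.
T-next-< : ∀ p r c w → T 0 (suc p) r c w * q (suc c + r) ≡ T 0 p r (suc c) w * q (suc c)
T-next-< p r c w = begin
  E * (1 * qb c r * qb r w) * q (suc c + r)         ≡⟨ pull E (qb c r) (qb r w) _ ⟩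
  E * (qb c r * q (suc c + r) * qb r w)             ≡⟨ cong (λ x → E * (x * qb r w)) (qb-sucˡ c r) ⟨
  E * (qb (suc c) r * q (suc c) * qb r w)           ≡⟨ pull E (qb (suc c) r) (qb r w) _ ⟨
  E * (1 * qb (suc c) r * qb r w) * q (suc c)       ∎
  where
  open ≡-Reasoning
  E = 2 ^ (r * r + choose2 0)
  pull : ∀ E x y z → E * (1 * x * y) * z ≡ E * (x * z * y)
  pull = solve-∀

-- Bounds u(p-1)/u(p) in the original parameters. For positive `p` it is the equality `T-prev`; for
-- `p = 0` the left side is 0.
T-prev-bound : ∀ s p r c w {m d j i} →
  i ≡ s + p → j ≡ s + suc r → d ≡ p + (c + j) → m ≡ w + j → p ≤ w →
  prev (coef m d j i) p * (2 ^ suc r * (q (suc s) * q (suc c) * q (suc r + w))) ≤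
  T s p (suc r) c w * (q p * q (suc c + (s + suc r)) * q (suc r))
T-prev-bound s zero    r c w i≡ j≡ d≡ m≡ p≤w = z≤n
T-prev-bound s (suc p) r c w {d = d} {j} i≡ j≡ d≡ m≡ p≤w = ≤-reflexive (trans
  (cong (_* (2 ^ suc r * (q (suc s) * q (suc c) * q (suc r + w))))
    (coef-T (suc s) p r (suc c) w (trans i≡ (+-suc s p)) (trans j≡ (+-suc s r))
      (trans d≡ (sym (+-suc p (c + j)))) m≡ (<⇒≤ p≤w)))
  (T-prev s p r c w))

-- Inequalities between the ratios

-- Of the exponent s + (c + 1) + (r + 1), the part 2^s is absorbed by `q (suc s)`; the rest joins
-- `q p`, giving at most `q (suc r + w)` by `suc c + p ≤ w`.
ratio-≤1 : ∀ s p r c w → suc c + p ≤ w →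
  q p * q (suc c + (s + suc r)) * q (suc r) ≤ 2 ^ suc r * (q (suc s) * q (suc c) * q (suc r + w))
ratio-≤1 s p r c w c+p<w = begin
  q p * q (suc c + (s + suc r)) * q (suc r)
    ≤⟨ *-mono-≤ head (q≤2^ (suc r)) ⟩
  q (suc s) * q (suc c) * q (suc r + w) * 2 ^ suc r
    ≡⟨ *-comm _ (2 ^ suc r) ⟩
  2 ^ suc r * (q (suc s) * q (suc c) * q (suc r + w)) ∎
  where
  open ≤-Reasoning
  split : ∀ x y z → x * (y * z) ≡ y * 1 * (x * z)
  split = solve-∀
  reorder : ∀ c s r → suc c + (s + suc r) ≡ s + (suc c + suc r)
  reorder = solve-∀
  reorder′ : ∀ c p r → p + (suc c + suc r) ≡ suc r + (suc c + p)
  reorder′ = solve-∀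
  head : q p * q (suc c + (s + suc r)) ≤ q (suc s) * q (suc c) * q (suc r + w)
  head = begin
    q p * q (suc c + (s + suc r))          ≤⟨ *-monoʳ-≤ (q p) (q≤2^ (suc c + (s + suc r))) ⟩
    q p * 2 ^ (suc c + (s + suc r))        ≡⟨ cong (λ x → q p * 2 ^ x) (reorder c s r) ⟩
    q p * 2 ^ (s + (suc c + suc r))        ≡⟨ cong (q p *_) (^-distribˡ-+-* 2 s (suc c + suc r)) ⟩
    q p * (2 ^ s * 2 ^ (suc c + suc r))    ≡⟨ split (q p) (2 ^ s) (2 ^ (suc c + suc r)) ⟩
    2 ^ s * 1 * (q p * 2 ^ (suc c + suc r)) ≤⟨ *-mono-≤ (*-mono-≤ (2^≤q-suc s) (q>0 c)) (q*2^≤q p (suc c + suc r)) ⟩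
    q (suc s) * q (suc c) * q (p + (suc c + suc r)) ≡⟨ cong (λ x → q (suc s) * q (suc c) * q x) (reorder′ c p r) ⟩
    q (suc s) * q (suc c) * q (suc r + (suc c + p)) ≤⟨ *-monoʳ-≤ (q (suc s) * q (suc c)) (q-mono (+-monoʳ-≤ (suc r) c+p<w)) ⟩
    q (suc s) * q (suc c) * q (suc r + w) ∎

-- With j = r + 1, the second ratio is 2^(-j), and the first is below 1 - 2^(-j) because the product
-- of its first two factors is less than `K`.
ratio-sum-< : ∀ p r c w → suc c + p ≤ w →
  q p * q (suc c + suc r) * q (suc r) + 1 * q (suc c) * q (suc r + w) <
  2 ^ suc r * (1 * q (suc c) * q (suc r + w))
ratio-sum-< p r c w c+p<w = begin-strict
  q p * q (suc c + suc r) * q (suc r) + K   <⟨ +-monoˡ-< K (*-monoˡ-< (q (suc r)) {{q-nonZero r}} head) ⟩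
  K * q (suc r) + K                         ≡⟨ collect K (q (suc r)) ⟩
  suc (q (suc r)) * K                       ≡⟨ cong (_* K) (1+q≡2^ (suc r)) ⟩
  2 ^ suc r * K                             ∎
  where
  open ≤-Reasoning
  K = 1 * q (suc c) * q (suc r + w)
  collect : ∀ k x → k * x + k ≡ suc x * k
  collect = solve-∀
  reorder : ∀ p c r → p + suc (c + suc r) ≡ suc r + (suc c + p)
  reorder = solve-∀
  head : q p * q (suc c + suc r) < K
  head = begin-strict
    q p * q (suc c + suc r)          <⟨ q*q<q p (c + suc r) ⟩
    q (p + suc (c + suc r))          ≡⟨ cong q (reorder p c r) ⟩
    q (suc r + (suc c + p))          ≤⟨ q-mono (+-monoʳ-≤ (suc r) c+p<w) ⟩
    q (suc r + w)                    ≡⟨ *-identityˡ _ ⟨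
    1 * q (suc r + w)                ≤⟨ *-monoˡ-≤ (q (suc r + w)) (≤-trans (q>0 c) (≤-reflexive (sym (*-identityˡ _)))) ⟩
    K                                ∎

-- Bounding the factors that involve `s` by powers of 2 lets 2^s be pulled out; a polynomial
-- inequality in `q p` and `q (suc r)` remains.
ratio-sum-≥ : ∀ s p r w → suc p ≤ w →
  q p * q (suc (s + suc r)) * q (suc r) + q (suc s + p) * 1 * q (suc r) <
  2 ^ suc r * (q (suc s) * 1 * q (suc r + w))
ratio-sum-≥ s p r w p<w = begin-strict
  x * q (suc (s + suc r)) * y + q (suc s + p) * 1 * y
    ≤⟨ +-mono-≤ (*-monoˡ-≤ y (*-monoʳ-≤ x (q≤2^ (suc (s + suc r)))))
                (*-monoˡ-≤ y (*-monoˡ-≤ 1 (q≤2^ (suc s + p)))) ⟩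
  x * (2 * 2 ^ (s + suc r)) * y + 2 * 2 ^ (s + p) * 1 * y
    ≡⟨ cong₂ (λ u v → x * (2 * u) * y + 2 * v * 1 * y) (pow-+ (suc r)) (pow-+ p) ⟩
  x * (2 * (S * suc y)) * y + 2 * (S * suc x) * 1 * y
    ≡⟨ factor S x y ⟩
  S * (2 * (x * y * y) + 4 * (x * y) + 2 * y)
    -- The right side exceeds the left by 2y² + y + 2x + 1, as `margin` records.
    <⟨ *-monoʳ-< S {{m^n≢0 2 s}} (≤-trans (m≤m+n _ (2 * (y * y) + y + 2 * x)) (≤-reflexive (margin x y))) ⟩
  S * (suc y * (1 * (x * y + x + y) + 1 + (x * y + x + y)))
    ≡⟨ cong (λ u → S * (suc y * (1 * u + 1 + u))) (q-+ p (suc r)) ⟨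
  S * (suc y * (1 * q (p + suc r) + 1 + q (p + suc r)))
    ≡⟨ cong (λ u → S * (suc y * u)) (q-+ 1 (p + suc r)) ⟨
  S * (suc y * q (suc (p + suc r)))
    ≡⟨ cong (λ u → S * (suc y * q u)) (+-comm (suc p) (suc r)) ⟩
  S * (suc y * q (suc r + suc p))
    ≤⟨ *-mono-≤ (2^≤q-suc s) (*-monoʳ-≤ (suc y) (q-mono (+-monoʳ-≤ (suc r) p<w))) ⟩
  q (suc s) * (suc y * q (suc r + w))
    ≡⟨ swap (q (suc s)) (suc y) (q (suc r + w)) ⟩
  suc y * (q (suc s) * 1 * q (suc r + w))
    ≡⟨ cong (_* (q (suc s) * 1 * q (suc r + w))) (1+q≡2^ (suc r)) ⟩
  2 ^ suc r * (q (suc s) * 1 * q (suc r + w)) ∎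
  where
  open ≤-Reasoning
  S = 2 ^ s
  x = q p
  y = q (suc r)
  pow-+ : ∀ k → 2 ^ (s + k) ≡ S * suc (q k)
  pow-+ k = trans (^-distribˡ-+-* 2 s k) (cong (S *_) (sym (1+q≡2^ k)))
  factor : ∀ S x y → x * (2 * (S * suc y)) * y + 2 * (S * suc x) * 1 * y ≡ S * (2 * (x * y * y) + 4 * (x * y) + 2 * y)
  factor = solve-∀
  margin : ∀ x y → suc (2 * (x * y * y) + 4 * (x * y) + 2 * y) + (2 * (y * y) + y + 2 * x) ≡
    suc y * (1 * (x * y + x + y) + 1 + (x * y + x + y))
  margin = solve-∀
  swap : ∀ a b c → a * (b * c) ≡ b * (a * 1 * c)
  swap = solve-∀

-- G_j(i) through its leading summand

-- The factor [d-h, j] vanishes. If h > d, the truncated `d ∸ h` is 0, which `1 ≤ j` still keeps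
-- below `j`.
d<h+j⇒coef≡0 : ∀ m d i h {j} → 1 ≤ j → d < h + j → coef m d j i h ≡ 0
d<h+j⇒coef≡0 m d i h {j} 1≤j d<h+j
  rewrite gauss2-zero (m<n+o⇒m∸n<o d h {{>-nonZero 1≤j}} d<h+j) | *-zeroʳ (gauss2 i h) =
  *-zeroʳ (2 ^ (j * (j ∸ (i ∸ h)) + choose2 (i ∸ h)))

-- The last Gaussian factor vanishes, since m - i + h < m - j.
j+h<i⇒coef≡0 : ∀ m d i h {j} → i ≤ m → j + h < i → coef m d j i h ≡ 0
j+h<i⇒coef≡0 m d i h {j} i≤m j+h<i =
  trans (cong (λ x → E * (B * x)) (gauss2-zero top)) (trans (cong (E *_) (*-zeroʳ B)) (*-zeroʳ E))
  where
  E = 2 ^ (j * (j ∸ (i ∸ h)) + choose2 (i ∸ h))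
  B = gauss2 i h * gauss2 (d ∸ h) j
  open ≤-Reasoning
  top : m ∸ i + h < m ∸ j
  top = +-cancelʳ-< j _ _ (begin-strict
    m ∸ i + h + j    ≡⟨ trans (+-assoc (m ∸ i) h j) (cong (m ∸ i +_) (+-comm h j)) ⟩
    m ∸ i + (j + h)  <⟨ +-monoʳ-< (m ∸ i) j+h<i ⟩
    m ∸ i + i        ≡⟨ m∸n+n≡m i≤m ⟩
    m                ≡⟨ m∸n+n≡m (≤-trans (m≤m+n j h) (≤-trans (<⇒≤ j+h<i) i≤m)) ⟨
    m ∸ j + j        ∎)

≤⇒∃+ : ∀ {a b} → a ≤ b → ∃ λ k → b ≡ k + a
≤⇒∃+ {a} {b} a≤b = b ∸ a , sym (m∸n+n≡m a≤b)

d<m⇒c+p<w : ∀ p c w {j} → p + (c + j) < w + j → suc c + p ≤ w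
d<m⇒c+p<w p c w {j} lt = +-cancelʳ-< j (c + p) w (subst (_< w + j) (reorder p c j) lt)
  where
  reorder : ∀ p c j → p + (c + j) ≡ c + p + j
  reorder = solve-∀

-- Either i > j + h and the smaller summand is 0, or the coordinates of `T` exist and the ratio of
-- the two summands is at most 1 by `ratio-≤1`.
coef-mono : ∀ {m d j i} h → d < m → j ≤ d → i ≤ d → suc h ≤ i → suc h + j ≤ d →
  coef m d j i h ≤ coef m d j i (suc h)
coef-mono {m} {d} {j} {i} h d<m j≤d i≤d h<i h+j<d with i ≤? j + h
... | no i≰ = ≤-trans (≤-reflexive (j+h<i⇒coef≡0 m d i h (≤-trans i≤d (<⇒≤ d<m)) (≰⇒> i≰))) z≤n
... | yes i≤ with ≤⇒∃+ h<i | ≤⇒∃+ h+j<d | ≤⇒∃+ (≤-trans j≤d (<⇒≤ d<m))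
...   | s , refl | c , d≡ | w , refl
  with ≤⇒∃+ (+-cancelʳ-≤ h (suc s) j (subst (_≤ j + h) (+-suc s h) i≤))
...     | r , refl = subst (coef m d j i h ≤_) (sym (coef-T s (suc h) (suc r) c w refl j≡ d≡′ refl h<w))
  (*-cancelʳ-≤ _ _ D {{D-nonZero}} (≤-trans
    (T-prev-bound s (suc h) r c w {d = d} refl j≡ d≡′ refl h<w)
    (*-monoʳ-≤ (T s (suc h) (suc r) c w) (ratio-≤1 s (suc h) r c w c+h<w))))
  where
  j≡ : r + suc s ≡ s + suc r
  j≡ = trans (+-comm r (suc s)) (sym (+-suc s r))
  reorder : ∀ c h j → c + (h + j) ≡ h + (c + j)
  reorder = solve-∀
  d≡′ : d ≡ suc h + (c + j)
  d≡′ = trans d≡ (reorder c (suc h) j)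
  c+h<w : suc c + suc h ≤ w
  c+h<w = d<m⇒c+p<w (suc h) c w (subst (_< w + j) d≡′ d<m)
  h<w : suc h ≤ w
  h<w = ≤-trans (m≤n+m (suc h) (suc c)) c+h<w
  D : ℕ
  D = 2 ^ suc r * (q (suc s) * q (suc c) * q (suc r + w))
  D-nonZero : NonZero D
  D-nonZero = >-nonZero (*-mono-< (m^n>0 2 (suc r)) (*-mono-< (*-mono-< (q>0 s) (q>0 c)) (q>0 (r + w))))

-- The bounds on `p` and the final disjunction say p = min(i, d - j). Any summands beyond `p`
-- vanish, and those up to `p` increase.
∣G∣-alt : ∀ n d j i p → d < n ∸ d → 1 ≤ j → j ≤ d → i ≤ d → p ≤ i → p + j ≤ d → p ≡ i ⊎ p + j ≡ d →
  ∣ G n d j i ∣ ≡ alt (coef (n ∸ d) d j i) p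
∣G∣-alt n d j i p d<m 1≤j j≤d i≤d p≤i p+j≤d last = trans (cong ∣_∣ G≡) (∣sgn*∣ (i ∸ p) _)
  where
  u = coef (n ∸ d) d j i
  F : ℕ → ℤ.ℤ
  F h = sgn (i ∸ h) ℤ.* (ℤ.+ (2 ^ (j * (j ∸ (i ∸ h)) + choose2 (i ∸ h))))
    ℤ.* (ℤ.+ (gauss2 i h * gauss2 (d ∸ h) j * gauss2 (n ∸ d ∸ i + h) (n ∸ d ∸ j)))
  F≡ : ∀ h → F h ≡ sgn (i ∸ h) ℤ.* (ℤ.+ u h)
  F≡ h = trans (ℤₚ.*-assoc (sgn (i ∸ h)) _ _)
    (cong (sgn (i ∸ h) ℤ.*_) (sym (ℤₚ.pos-* (2 ^ (j * (j ∸ (i ∸ h)) + choose2 (i ∸ h))) _)))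
  u0 : ∀ h → p < h → h ≤ i → p ≡ i ⊎ p + j ≡ d → u h ≡ 0
  u0 h p<h h≤i (inj₁ refl) = contradiction h≤i (<⇒≱ p<h)
  u0 h p<h h≤i (inj₂ p+j≡d) = d<h+j⇒coef≡0 (n ∸ d) d i h 1≤j (subst (_< h + j) p+j≡d (+-monoˡ-< j p<h))
  F0 : ∀ h → p < h → h ≤ i ∸ p + p → F h ≡ ℤ.+ 0
  F0 h p<h h≤ = trans (F≡ h) (trans
    (cong (λ x → sgn (i ∸ h) ℤ.* (ℤ.+ x)) (u0 h p<h (subst (h ≤_) (m∸n+n≡m p≤i) h≤) last))
    (ℤₚ.*-zeroʳ (sgn (i ∸ h))))
  G≡ : sumTo i F ≡ sgn (i ∸ p) ℤ.* (ℤ.+ alt u p)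
  G≡ = trans (trans (cong (λ x → sumTo x F) (sym (m∸n+n≡m p≤i))) (sumTo-vanishing F p (i ∸ p) F0))
    (sumTo-alternating i F≡ p p≤i λ h h<p →
      coef-mono h d<m j≤d i≤d (≤-trans h<p p≤i) (≤-trans (+-monoˡ-≤ j h<p) p+j≤d))

-- Comparison of consecutive eigenvalues.

alt-< : ∀ u p u′ p′ → u′ p′ + prev u p < u p → alt u′ p′ < alt u p
alt-< u p u′ p′ lt = ≤-<-trans (alt≤ u′ p′)
  (+-cancelʳ-< (prev u p) _ _ (<-≤-trans lt (≤alt+prev u p)))

-- Adds the fractions M/D and N/D, which bound x/z and y/z.
sum-<-by-ratios : ∀ x y z D M N → 0 < z → x * D ≤ z * M → y * D ≤ z * N → M + N < D → y + x < z
sum-<-by-ratios x y z D M N z>0 xD≤ yD≤ M+N<D = *-cancelʳ-< D (y + x) z (begin-strict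
  (y + x) * D    ≡⟨ trans (*-distribʳ-+ D y x) (+-comm (y * D) (x * D)) ⟩
  x * D + y * D  ≤⟨ +-mono-≤ xD≤ yD≤ ⟩
  z * M + z * N  ≡⟨ *-distribˡ-+ z M N ⟨
  z * (M + N)    <⟨ *-monoʳ-< z {{>-nonZero z>0}} M+N<D ⟩
  z * D          ∎)
  where open ≤-Reasoning

-- The case i + 1 + j ≤ d: both sums keep their last index, so the coordinate `s` is 0. The ratio of
-- leading summands is weakened to 2^(-j) to share the denominator `2 ^ j * K` with the other ratio.
leading-< : ∀ i r c w {m d j} → j ≡ suc r → d ≡ suc i + (c + j) → m ≡ w + j → d < m →
  coef m d j (suc i) (suc i) + prev (coef m d j i) i < coef m d j i i
leading-< i r c w {m} {d} {j} refl refl refl d<m =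
  subst₂ (λ x y → x + prev (coef m d j i) i < y)
    (sym (coef-T 0 (suc i) j c w refl refl refl refl i<w))
    (sym (coef-T 0 i j (suc c) w refl refl d≡ refl (<⇒≤ i<w)))
    (sum-<-by-ratios _ T₂ T₀ (2 ^ j * K) _ K (T>0 0 i j (suc c) w)
      (T-prev-bound 0 i r (suc c) w {d = d} refl refl d≡ refl (<⇒≤ i<w)) T₂≤
      (ratio-sum-< i r (suc c) w c+i<w))
  where
  open ≤-Reasoning
  T₀ = T 0 i j (suc c) w
  T₂ = T 0 (suc i) j c w
  K = 1 * q (suc (suc c)) * q (j + w)
  d≡ : d ≡ i + (suc c + j)
  d≡ = sym (+-suc i (c + j))
  c+i<w : suc (suc c) + i ≤ w
  c+i<w = d<m⇒c+p<w i (suc c) w (subst (_< w + j) d≡ d<m)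
  i<w : suc i ≤ w
  i<w = ≤-trans (s≤s (m≤n+m i (suc c))) c+i<w
  T₂*2^j≤T₀ : T₂ * 2 ^ j ≤ T₀
  T₂*2^j≤T₀ = *-cancelʳ-≤ _ _ (q (suc c)) {{q-nonZero c}} (begin
    T₂ * 2 ^ j * q (suc c)     ≡⟨ trans (*-assoc T₂ (2 ^ j) _) (cong (T₂ *_) (*-comm (2 ^ j) (q (suc c)))) ⟩
    T₂ * (q (suc c) * 2 ^ j)   ≤⟨ *-monoʳ-≤ T₂ (q*2^≤q (suc c) j) ⟩
    T₂ * q (suc c + j)         ≡⟨ T-next-< i j c w ⟩
    T₀ * q (suc c)             ∎)
  T₂≤ : T₂ * (2 ^ j * K) ≤ T₀ * K
  T₂≤ = ≤-trans (≤-reflexive (sym (*-assoc T₂ (2 ^ j) K))) (*-monoˡ-≤ K T₂*2^j≤T₀)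

-- The case d ≤ i + j: both leading summands sit at p = d - j, so `c` is 0 and passing to i + 1 only
-- raises `s` and lowers the last coordinate `r`.
leading-≥ : ∀ s p r w {m d j i} → i ≡ s + p → j ≡ suc s + r → d ≡ p + j → m ≡ w + j → d < m →
  coef m d j (suc i) p + prev (coef m d j i) p < coef m d j i p
leading-≥ s p r w {m} {d} {j} {i} refl refl refl refl d<m =
  subst₂ (λ x y → x + prev (coef m d j i) p < y)
    (sym (coef-T (suc s) p r 0 w refl refl refl refl (<⇒≤ p<w)))
    (sym (coef-T s p (suc r) 0 w refl j≡ refl refl (<⇒≤ p<w)))
    (sum-<-by-ratios _ (T (suc s) p r 0 w) (T s p (suc r) 0 w) _ _ _ (T>0 s p (suc r) 0 w)
      (T-prev-bound s p r 0 w {d = d} refl j≡ refl refl (<⇒≤ p<w))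
      (≤-reflexive (T-next-≥ s p r w))
      (ratio-sum-≥ s p r w p<w))
  where
  j≡ : suc s + r ≡ s + suc r
  j≡ = sym (+-suc s r)
  p<w : suc p ≤ w
  p<w = d<m⇒c+p<w p 0 w d<m

theorem3p7 : (n d : ℕ) → 1 ≤ d → 2 * d + 1 ≤ n →
    (i j : ℕ) → i + 1 ≤ d → 1 ≤ j → j ≤ d →
    ∣ G n d j (suc i) ∣ < ∣ G n d j i ∣
theorem3p7 n d 1≤d 2d<n i j i+1≤d 1≤j j≤d = go (suc i + j ≤? d)
  where
  u = coef (n ∸ d) d j
  i<d : suc i ≤ d
  i<d = subst (_≤ d) (+-comm i 1) i+1≤d
  d<m : d < n ∸ d
  d<m = m+n≤o⇒m≤o∸n (suc d) (≤-trans (≤-reflexive (double d)) 2d<n)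
    where
    double : ∀ d → suc d + d ≡ 2 * d + 1
    double = solve-∀
  ∣G∣≡ : ∀ i p → i ≤ d → p ≤ i → p + j ≤ d → p ≡ i ⊎ p + j ≡ d → ∣ G n d j i ∣ ≡ alt (u i) p
  ∣G∣≡ i p = ∣G∣-alt n d j i p d<m 1≤j j≤d
  from-leading : ∀ p p′ → ∣ G n d j i ∣ ≡ alt (u i) p → ∣ G n d j (suc i) ∣ ≡ alt (u (suc i)) p′ →
    u (suc i) p′ + prev (u i) p < u i p → ∣ G n d j (suc i) ∣ < ∣ G n d j i ∣
  from-leading p p′ eq eq′ lt = subst₂ _<_ (sym eq′) (sym eq) (alt-< (u i) p (u (suc i)) p′ lt)
  m≡ : ∃ λ w → n ∸ d ≡ w + j
  m≡ = ≤⇒∃+ (≤-trans j≤d (<⇒≤ d<m))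
  go : Dec (suc i + j ≤ d) → ∣ G n d j (suc i) ∣ < ∣ G n d j i ∣
  go (yes i+j<d) with ≤⇒∃+ i+j<d | ≤⇒∃+ 1≤j | m≡
  ... | c , d≡ | r , j≡ | w , m≡w = from-leading i (suc i)
    (∣G∣≡ i i (<⇒≤ i<d) ≤-refl (<⇒≤ i+j<d) (inj₁ refl))
    (∣G∣≡ (suc i) (suc i) i<d ≤-refl i+j<d (inj₁ refl))
    (leading-< i r c w (trans j≡ (+-comm r 1)) (trans d≡ (reorder c (suc i) j)) m≡w d<m)
    where
    reorder : ∀ c i j → c + (i + j) ≡ i + (c + j)
    reorder = solve-∀
  -- The witnesses are p = d - j, s = i - p and r = j - s - 1; the last exists because i < d = p +
  -- j.
  go (no i+j≮d) with ≤⇒∃+ j≤d | m≡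
  ... | p , d≡ | w , m≡w with ≤⇒∃+ p≤i
    where
    p≤i : p ≤ i
    p≤i = +-cancelʳ-≤ j p i (subst (_≤ i + j) d≡ (≮⇒≥ i+j≮d))
  ...   | s , i≡ with ≤⇒∃+ s<j
    where
    s<j : suc s ≤ j
    s<j = +-cancelʳ-≤ p (suc s) j (subst₂ _≤_ (cong suc i≡) (trans d≡ (+-comm p j)) i<d)
  ...     | r , j≡ = from-leading p p
    (∣G∣≡ i p (<⇒≤ i<d) p≤i (≤-reflexive (sym d≡)) (inj₂ (sym d≡)))
    (∣G∣≡ (suc i) p i<d (m≤n⇒m≤1+n p≤i) (≤-reflexive (sym d≡)) (inj₂ (sym d≡)))
    (leading-≥ s p r w i≡ (trans j≡ (+-comm r (suc s))) d≡ m≡w d<m)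
    where
    p≤i : p ≤ i
    p≤i = subst (p ≤_) (sym i≡) (m≤n+m p s)
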